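{- The bound $c\in\mathcal{O}(\lambda\sqrt n)$ on the packedness $c$ of $n$-vertex geometric graphs with $\lambda$-low density is tight: the $(\sqrt n\times\sqrt n)$-grid graph (for $n$ a perfect square) has $\lambda$-low density for some constant $\lambda\in\mathcal{O}(1)$ independent of $n$, but its packedness (the smallest $c$ such that it is $c$-packed) is $\Theta(\sqrt n)$.
   Context: A geometric graph is a finite simple undirected graph embedded in the plane: each vertex is associated with a point in $\mathbb{R}^2$, each edge is a straight-line segment between its endpoints and has its Euclidean length. Squares are axis-aligned, and the radius of a square is half its side length. A geometric graph $G$ has $\lambda$-low density if for each square $S$ of radius $r$ (for every $r>0$) there are at most $\lambda$ edges of $G$ that have length greater than $r$ and intersect $S$. A geometric graph $G$ is $c$-packed if for each square $S$ of radius $r$ (for every $r>0$) the total length of the edges of $G$ clipped to $S$ is at most $cr$. The $(\sqrt n\times\sqrt n)$-grid graph has vertex set $\{1,\dots,\sqrt n\}^2\subset\mathbb{R}^2$, with two vertices adjacent if and only if their Euclidean distance is $1$. -}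

module Defs where

open import Algebra.Bundles using (CommutativeRing)
open import Algebra.Structures using (IsCommutativeRing)
import Algebra.Definitions.RawMonoid as RawMonoidDefs
import Algebra.Properties.Ring as RingProperties
open import Data.Fin.Base as Fin using (Fin; toℕ; remQuot)
import Data.Fin.Properties as Fin
open import Data.List.Base using (List; length; map; foldr; filter; allFin; cartesianProduct)
open import Data.List.Membership.Propositional using () renaming (_∈_ to _∈ₗ_)
open import Data.List.Relation.Unary.All using (All)
open import Data.List.Relation.Unary.Unique.Propositional using (Unique)
open import Data.Nat.Base as ℕ using (ℕ; suc)
open import Data.Product.Base using (∃; ∃₂; ∃-syntax; _×_; _,_; proj₁; proj₂)
open import Data.Sum.Base using (_⊎_)
open import Level using (0ℓ)
open import Relation.Binary.Core using (Rel)
open import Relation.Binary.Definitions using (Decidable; Symmetric)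
open import Relation.Binary.PropositionalEquality.Core using (_≡_)
import Relation.Binary.Construct.NonStrictToStrict as ToStrict
open import Relation.Binary.Structures using (IsDecTotalOrder)
open import Relation.Nullary using (¬_; Dec)
open import Relation.Nullary.Decidable using (_×-dec_)
open import Relation.Unary using (Pred; Empty; Satisfiable; _∩_; _≐_)
import Relation.Unary as U

-- The real numbers, through their axiomatic characterisation as the
-- Dedekind-complete ordered field (unique up to isomorphism).  The order is
-- decidable, as for the classical reals.
record CompleteOrderedField : Set₁ where
  infix  4 _≈_ _≤_
  infixl 6 _+_
  infixl 7 _*_
  infix  8 -_
  field
    Carrier           : Set
    _≈_ _≤_           : Rel Carrier 0ℓ
    _+_ _*_           : Carrier → Carrier → Carrier
    -_                : Carrier → Carrier
    0# 1#             : Carrier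
    isCommutativeRing : IsCommutativeRing _≈_ _+_ _*_ -_ 0# 1#
    0≉1               : ¬ (0# ≈ 1#)
    inverse           : ∀ x → ¬ (x ≈ 0#) → ∃[ y ] x * y ≈ 1#
    isDecTotalOrder   : IsDecTotalOrder _≈_ _≤_
    +-monoʳ-≤         : ∀ z {x y} → x ≤ y → z + x ≤ z + y
    *-nonNegative     : ∀ {x y} → 0# ≤ x → 0# ≤ y → 0# ≤ x * y

  IsUpperBound : Pred Carrier 0ℓ → Carrier → Set
  IsUpperBound P b = ∀ x → P x → x ≤ b

  IsSupremum : Pred Carrier 0ℓ → Carrier → Set
  IsSupremum P s = IsUpperBound P s × (∀ b → IsUpperBound P b → s ≤ b)

  field
    complete : ∀ (P : Pred Carrier 0ℓ) → ∃ P → ∃ (IsUpperBound P) →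
               ∃ (IsSupremum P)

  open ToStrict _≈_ _≤_ public using (_<_)

  commutativeRing : CommutativeRing 0ℓ 0ℓ
  commutativeRing = record { isCommutativeRing = isCommutativeRing }

  open CommutativeRing commutativeRing public
    using (_-_; ring; +-rawMonoid)

  fromℕ : ℕ → Carrier
  fromℕ n = RawMonoidDefs._×_ +-rawMonoid n 1#

module Geometry (ℝ : CompleteOrderedField) where

  open CompleteOrderedField ℝ
  private
    module R = CommutativeRing commutativeRing
    module O = IsDecTotalOrder isDecTotalOrder
    module RP = RingProperties ring

  Point : Set
  Point = Carrier × Carrier

  sqDist : Point → Point → Carrier
  sqDist (a , b) (c , d) = (a - c) * (a - c) + (b - d) * (b - d)

  -- d is the square root of sqDist p q, i.e. the Euclidean distance.
  IsDistance : Point → Point → Carrier → Set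
  IsDistance p q d = 0# ≤ d × d * d ≈ sqDist p q

  Segment : Point → Point → Pred Point 0ℓ
  Segment (a , b) (c , d) (x , y) =
    ∃[ t ] 0# ≤ t × t ≤ 1# × x ≈ a + t * (c - a) × y ≈ b + t * (d - b)

  -- The length of a set of points that is empty or a (possibly degenerate)
  -- segment; the intersection of a segment with a square is always of this form.
  HasLength : Pred Point 0ℓ → Carrier → Set
  HasLength A ℓ = (Empty A × ℓ ≈ 0#)
                ⊎ (∃₂ λ p q → A ≐ Segment p q × IsDistance p q ℓ)

  record Square : Set where
    field
      centre   : Point
      radius   : Carrier
      radius>0 : 0# < radius

  Region : Square → Pred Point 0ℓ
  Region S (x , y) = (a - r ≤ x × x ≤ a + r) × (b - r ≤ y × y ≤ b + r)
    where
      r = Square.radius S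
      a = proj₁ (Square.centre S)
      b = proj₂ (Square.centre S)

  record GeometricGraph (n : ℕ) : Set₁ where
    field
      position  : Fin n → Point
      Adjacent  : Rel (Fin n) 0ℓ
      adjacent? : Decidable Adjacent
      symmetric : Symmetric Adjacent
      loopless  : ∀ v → ¬ Adjacent v v

    -- An undirected edge {u, v} is represented once, by (u , v) with u < v.
    Edge : Set
    Edge = Fin n × Fin n

    IsEdge : Pred Edge 0ℓ
    IsEdge (u , v) = u Fin.< v × Adjacent u v

    isEdge? : U.Decidable IsEdge
    isEdge? (u , v) = (u Fin.<? v) ×-dec adjacent? u v

    edges : List Edge
    edges = filter isEdge? (cartesianProduct (allFin n) (allFin n))

    segment : Edge → Pred Point 0ℓ
    segment (u , v) = Segment (position u) (position v)

    IsEdgeLength : Edge → Carrier → Set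
    IsEdgeLength (u , v) = IsDistance (position u) (position v)

    LongAndIntersecting : Square → Pred Edge 0ℓ
    LongAndIntersecting S e =
      (∃[ d ] IsEdgeLength e d × Square.radius S < d)
      × Satisfiable (segment e ∩ Region S)

    sumOverEdges : (Edge → Carrier) → Carrier
    sumOverEdges ℓ = foldr _+_ 0# (map ℓ edges)

  -- "At most λ edges": no duplicate-free list of such edges is longer than λ.
  LowDensity : ∀ {n} → ℕ → GeometricGraph n → Set
  LowDensity bound G = ∀ (S : Square) (es : List Edge) → Unique es →
    All (λ e → e ∈ₗ edges × LongAndIntersecting S e) es →
    length es ℕ.≤ bound
    where open GeometricGraph G

  Packed : ∀ {n} → Carrier → GeometricGraph n → Set
  Packed c G = ∀ (S : Square) (ℓ : Edge → Carrier) →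
    (∀ e → e ∈ₗ edges → HasLength (segment e ∩ Region S) (ℓ e)) →
    sumOverEdges ℓ ≤ c * Square.radius S
    where open GeometricGraph G

  IsPackedness : ∀ {n} → GeometricGraph n → Carrier → Set
  IsPackedness G c = Packed c G × (∀ c′ → Packed c′ G → c ≤ c′)

  infix 4 _∈Θ_
  _∈Θ_ : (ℕ → Carrier) → (ℕ → Carrier) → Set
  f ∈Θ g = ∃₂ λ k₁ k₂ → 0# < k₁ × 0# < k₂ ×
    ∃[ m₀ ] ∀ m → m₀ ℕ.≤ m →
      0# ≤ k₁ * g m × k₁ * g m ≤ f m × f m ≤ k₂ * g m

  private
    sqDiff-sym : ∀ x y → (x - y) * (x - y) ≈ (y - x) * (y - x)
    sqDiff-sym x y = begin
      (x - y) * (x - y)          ≈⟨ RP.-‿involutive _ ⟨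
      - - ((x - y) * (x - y))    ≈⟨ R.-‿cong (RP.-‿distribˡ-* _ _) ⟩
      - (- (x - y) * (x - y))    ≈⟨ RP.-‿distribʳ-* _ _ ⟩
      - (x - y) * - (x - y)      ≈⟨ R.*-cong (RP.⁻¹-anti-homo-// x y) (RP.⁻¹-anti-homo-// x y) ⟩
      (y - x) * (y - x)          ∎
      where open import Relation.Binary.Reasoning.Setoid R.setoid

    sqDist-self : ∀ p → sqDist p p ≈ 0#
    sqDist-self (a , b) = R.trans (R.+-cong (sq a) (sq b)) (R.+-identityˡ 0#)
      where
        sq : ∀ x → (x - x) * (x - x) ≈ 0#
        sq x = R.trans (R.*-congʳ (R.-‿inverseʳ x)) (R.zeroˡ _)

  -- The (√n × √n)-grid on n = m * m vertices, so m is √n; remQuot enumerates the pairs of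
  -- Fin m × Fin m, so the positions run through {1, …, m}².
  gridPosition : ∀ m → Fin (m ℕ.* m) → Point
  gridPosition m v = fromℕ (suc (toℕ i)) , fromℕ (suc (toℕ j))
    where
      i = proj₁ (remQuot {m} m v)
      j = proj₂ (remQuot {m} m v)

  grid : ∀ m → GeometricGraph (m ℕ.* m)
  grid m = record
    { position  = gridPosition m
    ; Adjacent  = λ u v → IsDistance (gridPosition m u) (gridPosition m v) 1#
    ; adjacent? = λ u v → (0# O.≤? 1#) ×-dec
        (1# * 1# O.≟ sqDist (gridPosition m u) (gridPosition m v))
    ; symmetric = λ (0≤1 , eq) →
        0≤1 , R.trans eq (R.+-cong (sqDiff-sym _ _) (sqDiff-sym _ _))
    ; loopless  = λ v (_ , eq) →
        0≉1 (R.sym (R.trans (R.sym (R.*-identityˡ 1#))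
                            (R.trans eq (sqDist-self (gridPosition m v)))))
    }

-- Low density: an edge of the grid has length 1, so a square meeting an edge longer than its
-- radius has radius at most 1, and the integer coordinates of the endpoints of all such edges
-- lie in a range of width 4; they are therefore determined by their residues modulo 5.
--
-- Packedness: let Φ (x , y) be the sum of the coordinates of the point of the square nearest to
-- (x , y).  The part of an edge (u , v) inside the square has length at most Φ v - Φ u, and
-- this telescopes along every row and every column to at most 4r.  With 2m lines, the grid is
-- 8m-packed.  Conversely, a square of radius m around the origin contains all the m(m-1)
-- edges along the rows, so that c ≥ m - 1.
module Submission where

open import Defs
import Algebra.Construct.NaturalChoice.Max as Max
import Algebra.Construct.NaturalChoice.Min as Min
open import Algebra.Bundles using (CommutativeRing)
open import Algebra.Solver.Ring.AlmostCommutativeRing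
  using (fromCommutativeRing; _-Raw-AlmostCommutative⟶_)
open import Data.Fin.Base as Fin using (Fin; zero; suc; toℕ; inject₁; combine)
import Data.Fin.Properties as Fin
open import Data.Integer.Base as ℤ using (ℤ; +_; -[1+_])
import Data.Integer.Properties as ℤ
open import Data.List.Base
  using (List; []; _∷_; _++_; length; lookup; map; foldr; tabulate; allFin;
         cartesianProduct; cartesianProductWith)
open import Data.List.Membership.Propositional using (_∈_)
open import Data.List.Membership.Propositional.Properties
  using (∈-lookup; ∈-allFin; ∈-∃++; ∈-++⁺ˡ; ∈-++⁺ʳ; ∈-++⁻; ∈-filter⁺; ∈-filter⁻;
         ∈-cartesianProduct⁺; ∈-cartesianProductWith⁺; ∈-cartesianProductWith⁻)
import Data.List.Properties as List
open import Data.List.Relation.Binary.Subset.Propositional using (_⊆_)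
import Data.List.Relation.Unary.All as All
open import Data.List.Relation.Unary.AllPairs using ([]; _∷_)
open import Data.List.Relation.Unary.Any using (here; there)
open import Data.List.Relation.Unary.Unique.Propositional using (Unique)
import Data.List.Relation.Unary.Unique.Propositional.Properties as Unique
open import Data.Maybe.Base as Maybe using (Maybe)
open import Data.Nat.Base as ℕ using (ℕ; zero; suc; NonZero; ∣_-_∣)
open import Data.Nat.DivMod using (_%_; _/_; _mod_; m≡m%n+[m/n]*n; m%n<n)
import Data.Nat.Properties as ℕ
open import Data.Product.Base using (∃; ∃₂; ∃-syntax; _×_; _,_; proj₁; proj₂)
open import Data.Sum.Base as Sum using (_⊎_; inj₁; inj₂; [_,_]′)
open import Function.Base using (flip)
open import Relation.Binary.Bundles using (Poset; TotalOrder)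
open import Relation.Binary.PropositionalEquality as ≡ using (_≡_; module ≡-Reasoning)
import Relation.Binary.Reasoning.PartialOrder as ≤-Reasoning
import Relation.Binary.Reasoning.Setoid as SetoidReasoning
open import Relation.Binary.Structures using (IsDecTotalOrder)
open import Relation.Nullary using (¬_; contradiction)
open import Relation.Nullary.Decidable using (dec⇒maybe; decidable-stable)
open import Relation.Unary using (Pred; _∩_)

-- Ring normalisation with integer coefficients.

-- Coefficients in R itself would not do: to cancel x - x the solver must decide that 1 - 1 is 0.
module IntegerRingSolver {c ℓ} (R : CommutativeRing c ℓ) where

  open CommutativeRing R
  open import Algebra.Properties.Ring ring
    using (-‿distribˡ-*; -‿distribʳ-*; -‿involutive; -0#≈0#; -‿+-comm)
  open import Algebra.Properties.Semiring.Mult.TCOptimised semiring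
    using (×1-homo-*; ×-homo-+) renaming (_×_ to _•_)
  open SetoidReasoning setoid

  -- The optimised multiples make `1 • 1#` reduce to `1#`, so that `con ℤ.1ℤ` in a solved identity
  -- stands for `1#` itself.
  fromℤ : ℤ → Carrier
  fromℤ (+ n)    = n • 1#
  fromℤ -[1+ n ] = - (suc n • 1#)

  private

    1+• : ∀ n → suc n • 1# ≈ 1# + n • 1#
    1+• = ×-homo-+ 1# 1

    fromℤ-⊖ : ∀ m n → fromℤ (m ℤ.⊖ n) ≈ m • 1# - n • 1#
    fromℤ-⊖ m       zero    = begin
      m • 1#            ≈⟨ +-identityʳ _ ⟨
      m • 1# + 0#       ≈⟨ +-congˡ -0#≈0# ⟨
      m • 1# - 0#       ∎
    fromℤ-⊖ zero    (suc n) = sym (+-identityˡ _)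
    fromℤ-⊖ (suc m) (suc n) = begin
      fromℤ (suc m ℤ.⊖ suc n)                     ≡⟨ ≡.cong fromℤ (ℤ.[1+m]⊖[1+n]≡m⊖n m n) ⟩
      fromℤ (m ℤ.⊖ n)                             ≈⟨ fromℤ-⊖ m n ⟩
      -- A vanishing `1# - 1#` is inserted here; each of its halves then completes one of the two
      -- multiples.
      m • 1# - n • 1#                             ≈⟨ +-congʳ (+-identityʳ _) ⟨
      m • 1# + 0# - n • 1#                        ≈⟨ +-congʳ (+-congˡ (-‿inverseʳ 1#)) ⟨
      m • 1# + (1# - 1#) - n • 1#                 ≈⟨ +-congʳ (+-assoc _ _ _) ⟨
      m • 1# + 1# - 1# - n • 1#                   ≈⟨ +-assoc _ _ _ ⟩
      m • 1# + 1# + (- 1# - n • 1#)               ≈⟨ +-cong (+-comm _ _) (-‿+-comm _ _) ⟩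
      1# + m • 1# - (1# + n • 1#)                 ≈⟨ +-cong (1+• m) (-‿cong (1+• n)) ⟨
      suc m • 1# - suc n • 1#                     ∎

    fromℤ-neg : ∀ i → fromℤ (ℤ.- i) ≈ - fromℤ i
    fromℤ-neg (+ zero)   = sym -0#≈0#
    fromℤ-neg (+ suc n)  = refl
    fromℤ-neg -[1+ n ]   = sym (-‿involutive _)

    fromℤ-+ : ∀ i j → fromℤ (i ℤ.+ j) ≈ fromℤ i + fromℤ j
    fromℤ-+ (+ m)    (+ n)    = ×-homo-+ 1# m n
    fromℤ-+ (+ m)    -[1+ n ] = fromℤ-⊖ m (suc n)
    fromℤ-+ -[1+ m ] (+ n)    = trans (fromℤ-⊖ n (suc m)) (+-comm _ _)
    fromℤ-+ -[1+ m ] -[1+ n ] = begin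
      - (suc (suc (m ℕ.+ n)) • 1#)       ≡⟨ ≡.cong (λ k → - (k • 1#)) (ℕ.+-suc (suc m) n) ⟨
      - ((suc m ℕ.+ suc n) • 1#)         ≈⟨ -‿cong (×-homo-+ 1# (suc m) (suc n)) ⟩
      - (suc m • 1# + suc n • 1#)        ≈⟨ -‿+-comm _ _ ⟨
      - (suc m • 1#) - suc n • 1#        ∎

    fromℤ-*ℕ : ∀ i n → fromℤ (i ℤ.* + n) ≈ fromℤ i * (n • 1#)
    fromℤ-*ℕ (+ m)    n = begin
      fromℤ (+ m ℤ.* + n)        ≡⟨ ≡.cong fromℤ (ℤ.pos-* m n) ⟨
      (m ℕ.* n) • 1#             ≈⟨ ×1-homo-* m n ⟩
      (m • 1#) * (n • 1#)        ∎
    fromℤ-*ℕ -[1+ m ] n = begin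
      fromℤ (-[1+ m ] ℤ.* + n)         ≡⟨ ≡.cong fromℤ (ℤ.neg-distribˡ-* (+ suc m) (+ n)) ⟨
      fromℤ (ℤ.- (+ suc m ℤ.* + n))    ≈⟨ fromℤ-neg (+ suc m ℤ.* + n) ⟩
      - fromℤ (+ suc m ℤ.* + n)        ≈⟨ -‿cong (fromℤ-*ℕ (+ suc m) n) ⟩
      - ((suc m • 1#) * (n • 1#))      ≈⟨ -‿distribˡ-* _ _ ⟩
      - (suc m • 1#) * (n • 1#)        ∎

    fromℤ-* : ∀ i j → fromℤ (i ℤ.* j) ≈ fromℤ i * fromℤ j
    fromℤ-* i (+ n)    = fromℤ-*ℕ i n
    fromℤ-* i -[1+ n ] = begin
      fromℤ (i ℤ.* -[1+ n ])           ≡⟨ ≡.cong fromℤ (ℤ.neg-distribʳ-* i (+ suc n)) ⟨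
      fromℤ (ℤ.- (i ℤ.* + suc n))      ≈⟨ fromℤ-neg (i ℤ.* + suc n) ⟩
      - fromℤ (i ℤ.* + suc n)          ≈⟨ -‿cong (fromℤ-*ℕ i (suc n)) ⟩
      - (fromℤ i * (suc n • 1#))       ≈⟨ -‿distribʳ-* _ _ ⟩
      fromℤ i * - (suc n • 1#)         ∎

    homomorphism : ℤ.+-*-rawRing -Raw-AlmostCommutative⟶ fromCommutativeRing R
    homomorphism = record
      { ⟦_⟧    = fromℤ
      ; +-homo = fromℤ-+
      ; *-homo = fromℤ-*
      ; -‿homo = fromℤ-neg
      ; 0-homo = refl
      ; 1-homo = refl
      }

    _coeff≟_ : ∀ i j → Maybe (fromℤ i ≈ fromℤ j)
    i coeff≟ j = Maybe.map (λ eq → reflexive (≡.cong fromℤ eq)) (dec⇒maybe (i ℤ.≟ j))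

  open import Algebra.Solver.Ring
    ℤ.+-*-rawRing (fromCommutativeRing R) homomorphism _coeff≟_ public

-- Order and arithmetic in the field, and the natural numbers inside it.

module OrderedFieldProperties (ℝ : CompleteOrderedField) where

  open CompleteOrderedField ℝ

  module R = CommutativeRing commutativeRing
  module ≤ = IsDecTotalOrder isDecTotalOrder
  open IntegerRingSolver commutativeRing using (solve; _:=_; _:+_; _:*_; _:-_; :-_; con) public

  poset : Poset _ _ _
  poset = record { isPartialOrder = ≤.isPartialOrder }

  totalOrder : TotalOrder _ _ _
  totalOrder = record { isTotalOrder = ≤.isTotalOrder }

  open ≤-Reasoning poset

  ≤-respˡ-≈ : ∀ {x y z} → x ≈ y → x ≤ z → y ≤ z
  ≤-respˡ-≈ = ≤.≤-respˡ-≈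

  x≤y⇒0≤y-x : ∀ {x y} → x ≤ y → 0# ≤ y - x
  x≤y⇒0≤y-x {x} {y} x≤y = begin
    0#         ≈⟨ R.-‿inverseˡ x ⟨
    - x + x    ≤⟨ +-monoʳ-≤ (- x) x≤y ⟩
    - x + y    ≈⟨ R.+-comm _ _ ⟩
    y - x      ∎

  -- With the ring solver, an inequality is proved by exhibiting the difference of its
  -- sides as a manifestly nonnegative expression.
  difference : ∀ {x y e} → 0# ≤ e → y - x ≈ e → x ≤ y
  difference {x} {y} {e} 0≤e y-x≈e = begin
    x             ≈⟨ R.+-identityʳ x ⟨
    x + 0#        ≤⟨ +-monoʳ-≤ x 0≤e ⟩
    x + e         ≈⟨ R.+-congˡ y-x≈e ⟨
    x + (y - x)   ≈⟨ solve 2 (λ x y → x :+ (y :- x) := y) R.refl x y ⟩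
    y             ∎

  +-mono-≤ : ∀ {w x y z} → w ≤ x → y ≤ z → w + y ≤ x + z
  +-mono-≤ {w} {x} {y} {z} w≤x y≤z = begin
    w + y   ≤⟨ +-monoʳ-≤ w y≤z ⟩
    w + z   ≈⟨ R.+-comm _ _ ⟩
    z + w   ≤⟨ +-monoʳ-≤ z w≤x ⟩
    z + x   ≈⟨ R.+-comm _ _ ⟩
    x + z   ∎

  +-nonNegative : ∀ {x y} → 0# ≤ x → 0# ≤ y → 0# ≤ x + y
  +-nonNegative 0≤x 0≤y = ≤-respˡ-≈ (R.+-identityˡ 0#) (+-mono-≤ 0≤x 0≤y)

  *-monoˡ-≤ : ∀ {x y z} → 0# ≤ z → x ≤ y → x * z ≤ y * z
  *-monoˡ-≤ {x} {y} {z} 0≤z x≤y = difference (*-nonNegative (x≤y⇒0≤y-x x≤y) 0≤z)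
    (solve 3 (λ x y z → y :* z :- x :* z := (y :- x) :* z) R.refl x y z)

  ≰⇒> : ∀ {x y} → ¬ x ≤ y → y < x
  ≰⇒> {x} {y} x≰y =
    [ (λ x≤y → contradiction x≤y x≰y)
    , (λ y≤x → y≤x , λ y≈x → x≰y (≤.reflexive (R.sym y≈x))) ]′ (≤.total x y)

  <⇒≱ : ∀ {x y} → x < y → ¬ y ≤ x
  <⇒≱ (x≤y , x≉y) y≤x = x≉y (≤.antisym x≤y y≤x)

  0<y-x : ∀ {x y} → x < y → 0# < y - x
  0<y-x {x} {y} (x≤y , x≉y) = x≤y⇒0≤y-x x≤y , λ 0≈y-x → x≉y (begin-equality
    x            ≈⟨ R.+-identityˡ x ⟨
    0# + x       ≈⟨ R.+-congʳ 0≈y-x ⟩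
    y - x + x    ≈⟨ solve 2 (λ x y → y :- x :+ x := y) R.refl x y ⟩
    y            ∎)

  -- The product cannot vanish, since multiplying it by the inverse of `x` would give `y ≈ 0#`.
  *-positive : ∀ {x y} → 0# < x → 0# < y → 0# < x * y
  *-positive {x} {y} (0≤x , 0≉x) (0≤y , 0≉y) =
    *-nonNegative 0≤x 0≤y , λ 0≈xy → 0≉y (begin-equality
      0#              ≈⟨ R.zeroʳ x⁻¹ ⟨
      x⁻¹ * 0#        ≈⟨ R.*-congˡ 0≈xy ⟩
      x⁻¹ * (x * y)   ≈⟨ solve 3 (λ x x⁻¹ y → x⁻¹ :* (x :* y) := x :* x⁻¹ :* y) R.refl x x⁻¹ y ⟩
      x * x⁻¹ * y     ≈⟨ R.*-congʳ x*x⁻¹≈1 ⟩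
      1# * y          ≈⟨ R.*-identityˡ y ⟩
      y               ∎)
    where
    x⁻¹ = proj₁ (inverse x (λ x≈0 → 0≉x (R.sym x≈0)))
    x*x⁻¹≈1 = proj₂ (inverse x (λ x≈0 → 0≉x (R.sym x≈0)))

  -- Were `y < x`, then `(x - y) * z` would be positive, whereas its negative is `y * z - x * z`.
  -- Decidability of the order turns this refutation into the inequality.
  *-cancelʳ-≤ : ∀ {x y z} → 0# < z → x * z ≤ y * z → x ≤ y
  *-cancelʳ-≤ {x} {y} {z} 0<z xz≤yz = decidable-stable (x ≤.≤? y) λ x≰y →
    <⇒≱ (*-positive (0<y-x (≰⇒> x≰y)) 0<z) (difference (x≤y⇒0≤y-x xz≤yz)
      (solve 3 (λ x y z → con ℤ.0ℤ :- (x :- y) :* z := y :* z :- x :* z) R.refl x y z))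

  -- Were `y < x`, both factors of `(x - y) * (x + y)` would be positive. Lengths are known only
  -- through their squares, and this is how they are compared.
  x*x≤y*y⇒x≤y : ∀ {x y} → 0# ≤ y → x * x ≤ y * y → x ≤ y
  x*x≤y*y⇒x≤y {x} {y} 0≤y x²≤y² = decidable-stable (x ≤.≤? y) λ x≰y →
    let y<x = ≰⇒> x≰y
        0<x+y = begin-strict
          0#      ≤⟨ 0≤y ⟩
          y       <⟨ y<x ⟩
          x       ≈⟨ R.+-identityʳ x ⟨
          x + 0#  ≤⟨ +-monoʳ-≤ x 0≤y ⟩
          x + y   ∎
    in <⇒≱ (*-positive (0<y-x y<x) 0<x+y) (difference (x≤y⇒0≤y-x x²≤y²)
      (solve 2 (λ x y → con ℤ.0ℤ :- (x :- y) :* (x :+ y) := y :* y :- x :* x) R.refl x y))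

  0≤x*x : ∀ x → 0# ≤ x * x
  0≤x*x x = [ (λ 0≤x → *-nonNegative 0≤x 0≤x)
            , (λ x≤0 → difference (*-nonNegative (x≤y⇒0≤y-x x≤0) (x≤y⇒0≤y-x x≤0))
                (solve 1 (λ x → x :* x :- con ℤ.0ℤ
                              := (con ℤ.0ℤ :- x) :* (con ℤ.0ℤ :- x)) R.refl x)) ]′
            (≤.total 0# x)

  0≤1 : 0# ≤ 1#
  0≤1 = begin
    0#        ≤⟨ 0≤x*x 1# ⟩
    1# * 1#   ≈⟨ R.*-identityˡ 1# ⟩
    1#        ∎

  0<1 : 0# < 1#
  0<1 = 0≤1 , 0≉1

  -y≤x≤y⇒x*x≤y*y : ∀ {x y} → - y ≤ x → x ≤ y → x * x ≤ y * y
  -y≤x≤y⇒x*x≤y*y {x} {y} -y≤x x≤y =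
    difference (*-nonNegative (x≤y⇒0≤y-x -y≤x) (x≤y⇒0≤y-x x≤y))
      (solve 2 (λ x y → y :* y :- x :* x := (x :- :- y) :* (y :- x)) R.refl x y)

  open import Algebra.Properties.Semiring.Mult R.semiring using (×-homo-+; ×1-homo-*)

  fromℕ-+ : ∀ m n → fromℕ (m ℕ.+ n) ≈ fromℕ m + fromℕ n
  fromℕ-+ = ×-homo-+ 1#

  fromℕ-* : ∀ m n → fromℕ (m ℕ.* n) ≈ fromℕ m * fromℕ n
  fromℕ-* = ×1-homo-*

  0≤fromℕ : ∀ n → 0# ≤ fromℕ n
  0≤fromℕ zero    = ≤.refl
  0≤fromℕ (suc n) = +-nonNegative 0≤1 (0≤fromℕ n)

  fromℕ-mono-≤ : ∀ {m n} → m ℕ.≤ n → fromℕ m ≤ fromℕ n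
  fromℕ-mono-≤ {n = n} ℕ.z≤n   = 0≤fromℕ n
  fromℕ-mono-≤ (ℕ.s≤s m≤n)     = +-monoʳ-≤ 1# (fromℕ-mono-≤ m≤n)

  0<fromℕ-suc : ∀ n → 0# < fromℕ (suc n)
  0<fromℕ-suc n = begin-strict
    0#             <⟨ 0<1 ⟩
    1#             ≈⟨ R.+-identityʳ 1# ⟨
    1# + 0#        ≤⟨ +-monoʳ-≤ 1# (0≤fromℕ n) ⟩
    fromℕ (suc n)  ∎

  fromℕ-cancel-≤ : ∀ m n → fromℕ m ≤ fromℕ n → m ℕ.≤ n
  fromℕ-cancel-≤ zero    n       _  = ℕ.z≤n
  fromℕ-cancel-≤ (suc m) zero    le = contradiction le (<⇒≱ (0<fromℕ-suc m))
  fromℕ-cancel-≤ (suc m) (suc n) le = ℕ.s≤s (fromℕ-cancel-≤ m n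
    (difference (x≤y⇒0≤y-x le)
      (solve 2 (λ x y → y :- x := (con ℤ.1ℤ :+ y) :- (con ℤ.1ℤ :+ x)) R.refl (fromℕ m) (fromℕ n))))

  fromℕ-injective : ∀ {m n} → fromℕ m ≈ fromℕ n → m ≡ n
  fromℕ-injective {m} {n} eq = ℕ.≤-antisym
    (fromℕ-cancel-≤ m n (≤.reflexive eq)) (fromℕ-cancel-≤ n m (≤.reflexive (R.sym eq)))

  -- Squaring removes the sign, so the field difference may be replaced by `∣_-_∣`. Adjacency in the
  -- grid thereby becomes an equation in `ℕ`.
  fromℕ-sqDiff : ∀ m n → (fromℕ m - fromℕ n) * (fromℕ m - fromℕ n)
                        ≈ fromℕ (ℕ.∣ m - n ∣ ℕ.* ℕ.∣ m - n ∣)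
  fromℕ-sqDiff zero    n       = R.trans
    (solve 1 (λ x → (con ℤ.0ℤ :- x) :* (con ℤ.0ℤ :- x) := x :* x) R.refl (fromℕ n))
    (R.sym (fromℕ-* n n))
  fromℕ-sqDiff (suc m) zero    = R.trans
    (solve 1 (λ x → (x :- con ℤ.0ℤ) :* (x :- con ℤ.0ℤ) := x :* x) R.refl (fromℕ (suc m)))
    (R.sym (fromℕ-* (suc m) (suc m)))
  fromℕ-sqDiff (suc m) (suc n) = R.trans (R.*-cong shift shift) (fromℕ-sqDiff m n)
    where
    shift : fromℕ (suc m) - fromℕ (suc n) ≈ fromℕ m - fromℕ n
    shift = solve 2 (λ x y → (con ℤ.1ℤ :+ x) :- (con ℤ.1ℤ :+ y) := x :- y) R.refl
      (fromℕ m) (fromℕ n)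

-- Counting by codes, residues, and unit steps of the grid.

module GridCombinatorics where

  open ≡ using (refl; sym; trans; cong; cong₂; subst)

  module _ {a} {A : Set a} where

    lookup-injective : ∀ {xs : List A} → Unique xs →
                       ∀ i j → lookup xs i ≡ lookup xs j → i ≡ j
    lookup-injective (x∉ ∷ _)  zero    zero    _  = refl
    lookup-injective (x∉ ∷ _)  zero    (suc j) eq = contradiction eq (All.lookup x∉ (∈-lookup j))
    lookup-injective (x∉ ∷ _)  (suc i) zero    eq = contradiction (sym eq) (All.lookup x∉ (∈-lookup i))
    lookup-injective (_ ∷ xs!) (suc i) (suc j) eq = cong suc (lookup-injective xs! i j eq)

    -- Pigeonhole: indexing the list and then applying `f` injects `Fin (length xs)` into `Fin n`.
    -- Injectivity is asked only on the list because residue codes separate only edges near one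
    -- square.
    unique∧injective⇒length≤ : ∀ {n} {xs : List A} (f : A → Fin n) → Unique xs →
      (∀ {x y} → x ∈ xs → y ∈ xs → f x ≡ f y → x ≡ y) → length xs ℕ.≤ n
    unique∧injective⇒length≤ {xs = xs} f xs! f-inj =
      Fin.injective⇒≤ {f = λ i → f (lookup xs i)} λ {i} {j} eq →
        lookup-injective xs! i j (f-inj (∈-lookup i) (∈-lookup j) eq)

  -- With equal remainders, `∣ i - j ∣` is `n` times the distance of the quotients; being below `n`,
  -- it forces the quotients to agree.
  mod-injective-nearby : ∀ {i j} n .{{_ : NonZero n}} → ∣ i - j ∣ ℕ.< n →
                         i mod n ≡ j mod n → i ≡ j
  mod-injective-nearby {i} {j} n near eq = begin
    i                      ≡⟨ m≡m%n+[m/n]*n i n ⟩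
    i % n ℕ.+ i / n ℕ.* n  ≡⟨ cong₂ (λ r q → r ℕ.+ q ℕ.* n) %-eq /-eq ⟩
    j % n ℕ.+ j / n ℕ.* n  ≡⟨ m≡m%n+[m/n]*n j n ⟨
    j                      ∎
    where
    open ≡-Reasoning
    %-eq : i % n ≡ j % n
    %-eq = Fin.fromℕ<-injective _ _ (m%n<n i n) (m%n<n j n) eq
    scaled : ∣ i - j ∣ ≡ ∣ i / n - j / n ∣ ℕ.* n
    scaled = begin
      ∣ i - j ∣
        ≡⟨ cong₂ ∣_-_∣ (m≡m%n+[m/n]*n i n) (m≡m%n+[m/n]*n j n) ⟩
      ∣ i % n ℕ.+ i / n ℕ.* n - j % n ℕ.+ j / n ℕ.* n ∣
        ≡⟨ cong (λ r → ∣ r ℕ.+ i / n ℕ.* n - j % n ℕ.+ j / n ℕ.* n ∣) %-eq ⟩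
      ∣ j % n ℕ.+ i / n ℕ.* n - j % n ℕ.+ j / n ℕ.* n ∣
        ≡⟨ ℕ.∣m+n-m+o∣≡∣n-o∣ (j % n) _ _ ⟩
      ∣ i / n ℕ.* n - j / n ℕ.* n ∣
        ≡⟨ ℕ.*-distribʳ-∣-∣ n (i / n) (j / n) ⟨
      ∣ i / n - j / n ∣ ℕ.* n ∎
    /-eq : i / n ≡ j / n
    /-eq = ℕ.∣m-n∣≡0⇒m≡n (ℕ.n<1⇒n≡0 (ℕ.*-cancelʳ-< n _ 1
      (subst (ℕ._< 1 ℕ.* n) scaled (subst (∣ i - j ∣ ℕ.<_) (sym (ℕ.*-identityˡ n)) near))))

  ∣m-n∣≤o : ∀ {m n o} → m ℕ.≤ n ℕ.+ o → n ℕ.≤ m ℕ.+ o → ∣ m - n ∣ ℕ.≤ o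
  ∣m-n∣≤o {m} {n} {o} m≤n+o n≤m+o =
    [ (λ eq → subst (ℕ._≤ o) (sym eq) (ℕ.m≤n+o⇒m∸n≤o m n m≤n+o))
    , (λ eq → subst (ℕ._≤ o) (sym eq) (ℕ.m≤n+o⇒m∸n≤o n m n≤m+o)) ]′ (ℕ.∣m-n∣≡[m∸n]∨[n∸m] m n)

  ∣m-n∣≡1⇒consecutive : ∀ m n → ∣ m - n ∣ ≡ 1 → n ≡ suc m ⊎ m ≡ suc n
  ∣m-n∣≡1⇒consecutive zero    n       eq = inj₁ eq
  ∣m-n∣≡1⇒consecutive (suc m) zero    eq = inj₂ eq
  ∣m-n∣≡1⇒consecutive (suc m) (suc n) eq = Sum.map (cong suc) (cong suc) (∣m-n∣≡1⇒consecutive m n eq)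

  ∣n-1+n∣≡1 : ∀ n → ∣ n - suc n ∣ ≡ 1
  ∣n-1+n∣≡1 zero    = refl
  ∣n-1+n∣≡1 (suc n) = ∣n-1+n∣≡1 n

  -- Two positive squares add up to at least 2. Hence unit steps between lattice points are parallel
  -- to an axis, which separates rows from columns.
  m²+n²≡1 : ∀ m n → m ℕ.* m ℕ.+ n ℕ.* n ≡ 1 → (m ≡ 0 × n ≡ 1) ⊎ (m ≡ 1 × n ≡ 0)
  m²+n²≡1 zero    n       eq = inj₁ (refl , ℕ.m*n≡1⇒m≡1 n n eq)
  m²+n²≡1 (suc m) zero    eq = inj₂ (ℕ.m*n≡1⇒m≡1 (suc m) (suc m) (trans (sym (ℕ.+-identityʳ _)) eq) , refl)
  m²+n²≡1 (suc m) (suc n) eq = contradiction (ℕ.suc-injective eq) (λ eq′ →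
    ℕ.1+n≢0 (ℕ.m+n≡0⇒n≡0 (m ℕ.+ m ℕ.* suc m) eq′))

  -- Brings neighbouring indices into the form in which `step` lists them.
  consecutive : ∀ {k} (i j : Fin (suc k)) → toℕ j ≡ suc (toℕ i) → ∃[ l ] i ≡ inject₁ l × j ≡ suc l
  consecutive i (suc l) eq =
    l , Fin.toℕ-injective (trans (sym (ℕ.suc-injective eq)) (sym (Fin.toℕ-inject₁ l))) , refl

  quotient∧remainder-injective : ∀ {m} n {u v : Fin (m ℕ.* n)} →
    Fin.quotient {m} n u ≡ Fin.quotient {m} n v →
    Fin.remainder {m} n u ≡ Fin.remainder {m} n v → u ≡ v
  quotient∧remainder-injective {m} n {u} {v} q≡ r≡ = begin
    u                                                       ≡⟨ Fin.combine-remQuot {m} n u ⟨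
    combine (Fin.quotient {m} n u) (Fin.remainder {m} n u)  ≡⟨ cong₂ combine q≡ r≡ ⟩
    combine (Fin.quotient {m} n v) (Fin.remainder {m} n v)  ≡⟨ Fin.combine-remQuot {m} n v ⟩
    v                                                       ∎
    where open ≡-Reasoning

  combine-monoʳ-< : ∀ {m n} (i : Fin m) {j l : Fin n} → j Fin.< l → combine i j Fin.< combine i l
  combine-monoʳ-< {n = n} i {j} {l} j<l = begin-strict
    toℕ (combine i j)          ≡⟨ Fin.toℕ-combine i j ⟩
    n ℕ.* toℕ i ℕ.+ toℕ j      <⟨ ℕ.+-monoʳ-< (n ℕ.* toℕ i) j<l ⟩
    n ℕ.* toℕ i ℕ.+ toℕ l      ≡⟨ Fin.toℕ-combine i l ⟨
    toℕ (combine i l)          ∎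
    where open ℕ.≤-Reasoning

  module _ (k : ℕ) where

    private
      V = Fin (suc k ℕ.* suc k)

    -- `vertex` is `combine` for rows and `flip combine` for columns, so that each argument about
    -- lines is made once for both directions.
    step : (Fin (suc k) → Fin (suc k) → V) → Fin (suc k) → Fin k → V × V
    step vertex i l = vertex i (inject₁ l) , vertex i (suc l)

    lines : (Fin (suc k) → Fin (suc k) → V) → List (V × V)
    lines vertex = cartesianProductWith (step vertex) (allFin (suc k)) (allFin k)

    rows columns : List (V × V)
    rows    = lines combine
    columns = lines (flip combine)

    -- One index is constant and the other changes by one. `combine` numbers the vertices
    -- lexicographically, so the assumed order of the ends excludes the backward step.
    unitStep∈lines : ∀ i j i′ j′ → combine {suc k} {suc k} i j Fin.< combine i′ j′ →
      ∣ toℕ i - toℕ i′ ∣ ℕ.* ∣ toℕ i - toℕ i′ ∣ ℕ.+ ∣ toℕ j - toℕ j′ ∣ ℕ.* ∣ toℕ j - toℕ j′ ∣ ≡ 1 →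
      (combine i j , combine i′ j′) ∈ rows ++ columns
    unitStep∈lines i j i′ j′ u<v eq with m²+n²≡1 ∣ toℕ i - toℕ i′ ∣ ∣ toℕ j - toℕ j′ ∣ eq
    ... | inj₁ (Δi≡0 , Δj≡1) with refl ← Fin.toℕ-injective {i = i} {i′} (ℕ.∣m-n∣≡0⇒m≡n Δi≡0)
          with ∣m-n∣≡1⇒consecutive (toℕ j) (toℕ j′) Δj≡1
    ...   | inj₂ j≡1+j′ = contradiction u<v (ℕ.<-asym (combine-monoʳ-< i (ℕ.≤-reflexive (sym j≡1+j′))))
    ...   | inj₁ j′≡1+j with l , refl , refl ← consecutive j j′ j′≡1+j =
      ∈-++⁺ˡ (∈-cartesianProductWith⁺ (step combine) (∈-allFin i) (∈-allFin l))
    unitStep∈lines i j i′ j′ u<v eq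
        | inj₂ (Δi≡1 , Δj≡0) with refl ← Fin.toℕ-injective {i = j} {j′} (ℕ.∣m-n∣≡0⇒m≡n Δj≡0)
          with ∣m-n∣≡1⇒consecutive (toℕ i) (toℕ i′) Δi≡1
    ...   | inj₂ i≡1+i′ = contradiction u<v (ℕ.<-asym (Fin.combine-monoˡ-< j j (ℕ.≤-reflexive (sym i≡1+i′))))
    ...   | inj₁ i′≡1+i with l , refl , refl ← consecutive i i′ i′≡1+i =
      ∈-++⁺ʳ rows (∈-cartesianProductWith⁺ (step (flip combine)) (∈-allFin j) (∈-allFin l))

open GridCombinatorics

-- Finite sums and telescoping.

module FiniteSums (ℝ : CompleteOrderedField) where

  open CompleteOrderedField ℝ
  open OrderedFieldProperties ℝ
  open ≤-Reasoning poset

  sum : ∀ {A : Set} → (A → Carrier) → List A → Carrier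
  sum f xs = foldr _+_ 0# (map f xs)

  module _ {A : Set} where

    sum-++ : ∀ (f : A → Carrier) xs ys → sum f (xs ++ ys) ≈ sum f xs + sum f ys
    sum-++ f []       ys = R.sym (R.+-identityˡ _)
    sum-++ f (x ∷ xs) ys = R.trans (R.+-congˡ (sum-++ f xs ys)) (R.sym (R.+-assoc _ _ _))

    sum-mono-≤ : ∀ {f g : A → Carrier} xs → (∀ {x} → x ∈ xs → f x ≤ g x) → sum f xs ≤ sum g xs
    sum-mono-≤ []       f≤g = ≤.refl
    sum-mono-≤ (x ∷ xs) f≤g = +-mono-≤ (f≤g (here ≡.refl)) (sum-mono-≤ xs λ x∈ → f≤g (there x∈))

    sum-const : ∀ c (xs : List A) → sum (λ _ → c) xs ≈ fromℕ (length xs) * c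
    sum-const c []       = R.sym (R.zeroˡ c)
    sum-const c (x ∷ xs) = begin-equality
      c + sum (λ _ → c) xs         ≈⟨ R.+-congˡ (sum-const c xs) ⟩
      c + fromℕ (length xs) * c    ≈⟨ solve 2 (λ c n → c :+ n :* c := (con ℤ.1ℤ :+ n) :* c) R.refl c _ ⟩
      fromℕ (length (x ∷ xs)) * c  ∎

    sum-nonNegative : ∀ {f : A → Carrier} xs → (∀ {x} → x ∈ xs → 0# ≤ f x) → 0# ≤ sum f xs
    sum-nonNegative []       0≤f = ≤.refl
    sum-nonNegative (x ∷ xs) 0≤f =
      +-nonNegative (0≤f (here ≡.refl)) (sum-nonNegative xs λ x∈ → 0≤f (there x∈))

    -- Each `x` of the smaller list is cut out of the larger one; by uniqueness the remaining
    -- elements differ from `x` and survive the cut. This compares `edges` with explicit lists of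
    -- steps whatever the order of enumeration.
    sum-⊆ : ∀ {f : A → Carrier} {xs ys} → Unique xs → xs ⊆ ys →
            (∀ {y} → y ∈ ys → 0# ≤ f y) → sum f xs ≤ sum f ys
    sum-⊆ {ys = ys} [] xs⊆ys 0≤f = sum-nonNegative ys 0≤f
    sum-⊆ {f} {x ∷ xs} (x∉xs ∷ xs!) xs⊆ys 0≤f
      with as , bs , ≡.refl ← ∈-∃++ (xs⊆ys (here ≡.refl)) = begin
        f x + sum f xs                 ≤⟨ +-monoʳ-≤ (f x) (sum-⊆ xs! xs⊆as++bs 0≤f′) ⟩
        f x + sum f (as ++ bs)         ≈⟨ R.+-congˡ (sum-++ f as bs) ⟩
        f x + (sum f as + sum f bs)    ≈⟨ solve 3 (λ x a b → x :+ (a :+ b) := a :+ (x :+ b)) R.refl _ _ _ ⟩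
        sum f as + (f x + sum f bs)    ≈⟨ sum-++ f as (x ∷ bs) ⟨
        sum f (as ++ x ∷ bs)           ∎
      where
      xs⊆as++bs : xs ⊆ as ++ bs
      xs⊆as++bs y∈xs with ∈-++⁻ as (xs⊆ys (there y∈xs))
      ... | inj₁ y∈as            = ∈-++⁺ˡ y∈as
      ... | inj₂ (here ≡.refl)   = contradiction ≡.refl (All.lookup x∉xs y∈xs)
      ... | inj₂ (there y∈bs)    = ∈-++⁺ʳ as y∈bs
      0≤f′ : ∀ {y} → y ∈ as ++ bs → 0# ≤ f y
      0≤f′ y∈ = 0≤f ([ ∈-++⁺ˡ , (λ y∈bs → ∈-++⁺ʳ as (there y∈bs)) ]′ (∈-++⁻ as y∈))

  sum-cartesianProductWith : ∀ {A B C : Set} (f : C → Carrier) (g : A → B → C) xs ys →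
    sum f (cartesianProductWith g xs ys) ≈ sum (λ x → sum (λ y → f (g x y)) ys) xs
  sum-cartesianProductWith f g []       ys = R.refl
  sum-cartesianProductWith f g (x ∷ xs) ys = begin-equality
    sum f (map (g x) ys ++ cartesianProductWith g xs ys)         ≈⟨ sum-++ f (map (g x) ys) _ ⟩
    sum f (map (g x) ys) + sum f (cartesianProductWith g xs ys)  ≈⟨ R.+-cong
      (R.reflexive (≡.cong (foldr _+_ 0#) (≡.sym (List.map-∘ ys)))) (sum-cartesianProductWith f g xs ys) ⟩
    sum (λ y → f (g x y)) ys + sum (λ x → sum (λ y → f (g x y)) ys) xs   ∎

  telescope : ∀ k (g : Fin (suc k) → Carrier) →
              sum (λ l → g (suc l) - g (inject₁ l)) (allFin k) ≈ g (Fin.fromℕ k) - g zero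
  -- `allFin k` tabulates the identity; fusing the map into it gives a sum whose tail is the same
  -- sum for `g` shifted by one.
  telescope k g = R.trans (R.reflexive (≡.cong (foldr _+_ 0#)
    (List.map-tabulate (λ l → l) (λ l → g (suc l) - g (inject₁ l))))) (go k g)
    where
    go : ∀ k (g : Fin (suc k) → Carrier) →
         foldr _+_ 0# (tabulate (λ l → g (suc l) - g (inject₁ l))) ≈ g (Fin.fromℕ k) - g zero
    go zero    g = R.sym (R.-‿inverseʳ _)
    go (suc k) g = R.trans (R.+-congˡ (go k (λ l → g (suc l))))
      (solve 3 (λ x y z → y :- x :+ (z :- y) := z :- x) R.refl (g zero) (g (suc zero)) (g (Fin.fromℕ (suc k))))

-- Segments, boxes, and the part of an edge inside a square.

module PlaneGeometry (ℝ : CompleteOrderedField) where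

  open CompleteOrderedField ℝ
  open Geometry ℝ
  open OrderedFieldProperties ℝ
  open ≤-Reasoning poset
  open Max totalOrder using (_⊔_; ⊔-lub; ⊔-monoʳ-≤; x≤x⊔y; x≤y⊔x)
  open Min totalOrder using (_⊓_; ⊓-glb; ⊓-monoʳ-≤; x⊓y≤x; x⊓y≤y)

  -- The gap to `z` is the convex combination of the gaps at the two ends. Applied to all four
  -- sides, this and its dual give the convexity of boxes.
  interpolate-≤ : ∀ {a c t z} → 0# ≤ t → t ≤ 1# → a ≤ z → c ≤ z → a + t * (c - a) ≤ z
  interpolate-≤ {a} {c} {t} {z} 0≤t t≤1 a≤z c≤z = difference
    (+-nonNegative (*-nonNegative (x≤y⇒0≤y-x t≤1) (x≤y⇒0≤y-x a≤z))
                   (*-nonNegative 0≤t (x≤y⇒0≤y-x c≤z)))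
    (solve 4 (λ a c t z → z :- (a :+ t :* (c :- a))
                        := (con ℤ.1ℤ :- t) :* (z :- a) :+ t :* (z :- c)) R.refl a c t z)

  interpolate-≥ : ∀ {a c t z} → 0# ≤ t → t ≤ 1# → z ≤ a → z ≤ c → z ≤ a + t * (c - a)
  interpolate-≥ {a} {c} {t} {z} 0≤t t≤1 z≤a z≤c = difference
    (+-nonNegative (*-nonNegative (x≤y⇒0≤y-x t≤1) (x≤y⇒0≤y-x z≤a))
                   (*-nonNegative 0≤t (x≤y⇒0≤y-x z≤c)))
    (solve 4 (λ a c t z → a :+ t :* (c :- a) :- z
                        := (con ℤ.1ℤ :- t) :* (a :- z) :+ t :* (c :- z)) R.refl a c t z)

  Box : Point → Point → Pred Point _
  Box (a , b) (c , d) (x , y) = (a ≤ x × x ≤ c) × (b ≤ y × y ≤ d)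

  segment⊆box : ∀ {p q lo hi z} → Box lo hi p → Box lo hi q → Segment p q z → Box lo hi z
  segment⊆box ((a≤p , p≤c) , (b≤p , p≤d)) ((a≤q , q≤c) , (b≤q , q≤d)) (t , 0≤t , t≤1 , x≈ , y≈) =
    ( ≤.≤-respʳ-≈ (R.sym x≈) (interpolate-≥ 0≤t t≤1 a≤p a≤q)
    , ≤-respˡ-≈ (R.sym x≈) (interpolate-≤ 0≤t t≤1 p≤c q≤c)) ,
    ( ≤.≤-respʳ-≈ (R.sym y≈) (interpolate-≥ 0≤t t≤1 b≤p b≤q)
    , ≤-respˡ-≈ (R.sym y≈) (interpolate-≤ 0≤t t≤1 p≤d q≤d))

  start∈segment : ∀ p q → Segment p q p
  start∈segment (a , b) (c , d) = 0# , ≤.refl , 0≤1 , at-0 a c , at-0 b d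
    where
    at-0 : ∀ a c → a ≈ a + 0# * (c - a)
    at-0 = solve 2 (λ a c → a := a :+ con ℤ.0ℤ :* (c :- a)) R.refl

  end∈segment : ∀ p q → Segment p q q
  end∈segment (a , b) (c , d) = 1# , 0≤1 , ≤.refl , at-1 a c , at-1 b d
    where
    at-1 : ∀ a c → c ≈ a + 1# * (c - a)
    at-1 = solve 2 (λ a c → c := a :+ con ℤ.1ℤ :* (c :- a)) R.refl

  minus-mono-≤ : ∀ {l u s t} → s ≤ u → l ≤ t → s - t ≤ u - l
  minus-mono-≤ {l} {u} {s} {t} s≤u l≤t = difference
    (+-nonNegative (x≤y⇒0≤y-x s≤u) (x≤y⇒0≤y-x l≤t))
    (solve 4 (λ l u s t → u :- l :- (s :- t) := (u :- s) :+ (t :- l)) R.refl l u s t)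

  -minus-mono-≤ : ∀ {l u s t} → l ≤ s → t ≤ u → - (u - l) ≤ s - t
  -minus-mono-≤ {l} {u} {s} {t} l≤s t≤u = difference
    (+-nonNegative (x≤y⇒0≤y-x l≤s) (x≤y⇒0≤y-x t≤u))
    (solve 4 (λ l u s t → s :- t :- :- (u :- l) := (s :- l) :+ (u :- t)) R.refl l u s t)

  squares≤square : ∀ {s t D E} → - D ≤ s → s ≤ D → - E ≤ t → t ≤ E →
                   0# ≤ D → 0# ≤ E → s * s + t * t ≤ (D + E) * (D + E)
  squares≤square {s} {t} {D} {E} -D≤s s≤D -E≤t t≤E 0≤D 0≤E = begin
    s * s + t * t      ≤⟨ +-mono-≤ (-y≤x≤y⇒x*x≤y*y -D≤s s≤D) (-y≤x≤y⇒x*x≤y*y -E≤t t≤E) ⟩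
    D * D + E * E      ≤⟨ difference (+-nonNegative DE DE)
      (solve 2 (λ D E → (D :+ E) :* (D :+ E) :- (D :* D :+ E :* E) := D :* E :+ D :* E) R.refl D E) ⟩
    (D + E) * (D + E)  ∎
    where DE = *-nonNegative 0≤D 0≤E

  -- Each coordinate difference is at most a side of the box, and the two squared sides add up to at
  -- most the square of their sum. Width plus height replaces the diagonal because it splits into
  -- coordinates, as `potential` does.
  box-diameter : ∀ {lo hi p q d} → Box lo hi p → Box lo hi q → IsDistance p q d →
                 d ≤ (proj₁ hi - proj₁ lo) + (proj₂ hi - proj₂ lo)
  box-diameter ((a≤p , p≤c) , (b≤p , p≤d)) ((a≤q , q≤c) , (b≤q , q≤d)) (_ , dd) =
    x*x≤y*y⇒x≤y (+-nonNegative 0≤D 0≤E) (≤-respˡ-≈ (R.sym dd)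
      (squares≤square (-minus-mono-≤ a≤p q≤c) (minus-mono-≤ p≤c a≤q)
                      (-minus-mono-≤ b≤p q≤d) (minus-mono-≤ p≤d b≤q) 0≤D 0≤E))
    where
    0≤D = x≤y⇒0≤y-x (≤.trans a≤p p≤c)
    0≤E = x≤y⇒0≤y-x (≤.trans b≤p p≤d)

  -- For `lo ≤ hi`, the point of the interval nearest to `x`.
  clamp : Carrier → Carrier → Carrier → Carrier
  clamp lo hi x = lo ⊔ (hi ⊓ x)

  clamp-mono-≤ : ∀ {lo hi x y} → x ≤ y → clamp lo hi x ≤ clamp lo hi y
  clamp-mono-≤ {lo} {hi} x≤y = ⊔-monoʳ-≤ lo (⊓-monoʳ-≤ hi x≤y)

  lo≤clamp : ∀ lo hi x → lo ≤ clamp lo hi x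
  lo≤clamp lo hi x = x≤x⊔y lo (hi ⊓ x)

  clamp≤hi : ∀ {lo hi} x → lo ≤ hi → clamp lo hi x ≤ hi
  clamp≤hi {lo} {hi} x lo≤hi = ⊔-lub lo≤hi (x⊓y≤x hi x)

  clamp-≤ : ∀ {lo hi x z} → lo ≤ z → x ≤ z → clamp lo hi x ≤ z
  clamp-≤ {lo} {hi} {x} lo≤z x≤z = ⊔-lub lo≤z (≤.trans (x⊓y≤y hi x) x≤z)

  clamp-≥ : ∀ {lo hi x z} → z ≤ hi → z ≤ x → z ≤ clamp lo hi x
  clamp-≥ {lo} {hi} {x} z≤hi z≤x = ≤.trans (⊓-glb z≤hi z≤x) (x≤y⊔x lo (hi ⊓ x))

  distance-sym : ∀ {p q d} → IsDistance p q d → IsDistance q p d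
  distance-sym {a , b} {c , d} (0≤d , eq) = 0≤d , R.trans eq
    (solve 4 (λ a b c d → (a :- c) :* (a :- c) :+ (b :- d) :* (b :- d)
                        := (c :- a) :* (c :- a) :+ (d :- b) :* (d :- b)) R.refl a b c d)

  -- Distance is a relation, so two candidates are compared through their common square; this bounds
  -- any length of a grid edge by `1#`.
  distance-≤ : ∀ {p q d e} → IsDistance p q d → IsDistance p q e → d ≤ e
  distance-≤ (_ , dd) (0≤e , ee) = x*x≤y*y⇒x≤y 0≤e (≤.reflexive (R.trans dd (R.sym ee)))

  -- `d * d` exceeds the squared difference of the first coordinates by the square of the other
  -- difference.
  distance-x : ∀ {p q d} → IsDistance p q d → proj₁ p ≤ proj₁ q + d
  distance-x {a , b} {c , e} {d} (0≤d , dd) = difference (x≤y⇒0≤y-x a-c≤d)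
    (solve 3 (λ a c d → c :+ d :- a := d :- (a :- c)) R.refl a c d)
    where
    a-c≤d : a - c ≤ d
    a-c≤d = x*x≤y*y⇒x≤y 0≤d (difference (0≤x*x (b - e)) (begin-equality
      d * d - (a - c) * (a - c)
        ≈⟨ R.+-congʳ dd ⟩
      (a - c) * (a - c) + (b - e) * (b - e) - (a - c) * (a - c)
        ≈⟨ solve 2 (λ x y → x :+ y :- x := y) R.refl _ _ ⟩
      (b - e) * (b - e) ∎))

  distance-y : ∀ {p q d} → IsDistance p q d → proj₂ p ≤ proj₂ q + d
  distance-y {a , b} {c , e} {d} (0≤d , dd) =
    distance-x {b , a} {e , c} (0≤d , R.trans dd (R.+-comm _ _))

  module _ (S : Square) where

    open Square S

    lower upper : Carrier → Carrier
    lower z = z - radius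
    upper z = z + radius

    0≤radius : 0# ≤ radius
    0≤radius = proj₁ radius>0

    lower≤upper : ∀ z → lower z ≤ upper z
    lower≤upper z = difference (+-nonNegative 0≤radius 0≤radius)
      (solve 2 (λ z r → z :+ r :- (z :- r) := r :+ r) R.refl z radius)

    clampₓ clampᵧ : Carrier → Carrier
    clampₓ = clamp (lower (proj₁ centre)) (upper (proj₁ centre))
    clampᵧ = clamp (lower (proj₂ centre)) (upper (proj₂ centre))

    potential : Point → Carrier
    potential (x , y) = clampₓ x + clampᵧ y

    -- Each of the two clamped coordinates ranges over an interval of twice the radius.
    potential-spread : ∀ p q → potential p - potential q ≤ fromℕ 4 * radius
    potential-spread (x , y) (x′ , y′) = begin
      clampₓ x + clampᵧ y - (clampₓ x′ + clampᵧ y′)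
        ≈⟨ solve 4 (λ x y x′ y′ → x :+ y :- (x′ :+ y′) := (x :- x′) :+ (y :- y′)) R.refl _ _ _ _ ⟩
      (clampₓ x - clampₓ x′) + (clampᵧ y - clampᵧ y′)
        ≤⟨ +-mono-≤ (minus-mono-≤ (clamp≤hi x (lower≤upper _)) (lo≤clamp _ _ x′))
                    (minus-mono-≤ (clamp≤hi y (lower≤upper _)) (lo≤clamp _ _ y′)) ⟩
      (upper (proj₁ centre) - lower (proj₁ centre)) + (upper (proj₂ centre) - lower (proj₂ centre))
        -- `fromℕ 4` unfolds to four units followed by `0#`, and the numeral is spelled out to agree
        -- with it.
        ≈⟨ solve 3 (λ a b r → (a :+ r :- (a :- r)) :+ (b :+ r :- (b :- r))
             := (con ℤ.1ℤ :+ (con ℤ.1ℤ :+ (con ℤ.1ℤ :+ (con ℤ.1ℤ :+ con ℤ.0ℤ)))) :* r) R.refl _ _ _ ⟩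
      fromℕ 4 * radius ∎

    module _ {p q : Point} (x≤ : proj₁ p ≤ proj₁ q) (y≤ : proj₂ p ≤ proj₂ q) where

      private
        Dx = clampₓ (proj₁ q) - clampₓ (proj₁ p)
        Dy = clampᵧ (proj₂ q) - clampᵧ (proj₂ p)
        0≤Dx : 0# ≤ Dx
        0≤Dx = x≤y⇒0≤y-x (clamp-mono-≤ x≤)
        0≤Dy : 0# ≤ Dy
        0≤Dy = x≤y⇒0≤y-x (clamp-mono-≤ y≤)

        Dx+Dy : Dx + Dy ≈ potential q - potential p
        Dx+Dy = solve 4 (λ x y x′ y′ → (x :- x′) :+ (y :- y′) := x :+ y :- (x′ :+ y′)) R.refl _ _ _ _

        clampedBox : Point → Set
        clampedBox = Box (clampₓ (proj₁ p) , clampᵧ (proj₂ p)) (clampₓ (proj₁ q) , clampᵧ (proj₂ q))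

        -- A coordinate of `z` is at least that of `p` and the lower side of the square, hence at
        -- least the clamp of `p`; dually for `q`.
        box∩region⊆ : ∀ {z} → Box p q z → Region S z → clampedBox z
        box∩region⊆ ((p≤x , x≤q) , (p≤y , y≤q)) ((l≤x , x≤u) , (l≤y , y≤u)) =
          (clamp-≤ l≤x p≤x , clamp-≥ x≤u x≤q) , (clamp-≤ l≤y p≤y , clamp-≥ y≤u y≤q)

        clipped⊆ : ∀ {z} → (Segment p q ∩ Region S) z → clampedBox z
        clipped⊆ (z∈pq , z∈S) = box∩region⊆ (segment⊆box {p} {q}
          ((≤.refl , x≤) , (≤.refl , y≤)) ((x≤ , ≤.refl) , (y≤ , ≤.refl)) z∈pq) z∈S

      potential-mono : 0# ≤ potential q - potential p
      potential-mono = ≤.≤-respʳ-≈ Dx+Dy (+-nonNegative 0≤Dx 0≤Dy)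

      -- The ends of a nonempty clipped part belong to it, hence lie in the clamped box, whose width
      -- plus height is the difference of potentials. An empty part has length zero.
      clippedLength-≤ : ∀ {ℓ} → HasLength (Segment p q ∩ Region S) ℓ → ℓ ≤ potential q - potential p
      clippedLength-≤ {ℓ} (inj₁ (_ , ℓ≈0)) = ≤-respˡ-≈ (R.sym ℓ≈0) potential-mono
      clippedLength-≤ {ℓ} (inj₂ (s , t , (_ , st⊆) , dist)) = ≤.≤-respʳ-≈ Dx+Dy
        (box-diameter {d = ℓ} (clipped⊆ (st⊆ (start∈segment s t))) (clipped⊆ (st⊆ (end∈segment s t))) dist)

-- Packedness as a least upper bound.

module Packedness (ℝ : CompleteOrderedField) where

  open CompleteOrderedField ℝ
  open Geometry ℝ
  open OrderedFieldProperties ℝ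
  open ≤-Reasoning poset

  module _ {n} (G : GeometricGraph n) where

    open GeometricGraph G

    IsClipping : Square → (Edge → Carrier) → Set
    IsClipping S ℓ = ∀ e → e ∈ edges → HasLength (segment e ∩ Region S) (ℓ e)

    -- The admissible constants are the upper bounds of all quotients of clipped length by radius.
    -- The given clipping makes this set inhabited, the given constant bounds it, and completeness
    -- yields its least upper bound.
    packedness-exists : (∃₂ λ S ℓ → IsClipping S ℓ) → (∃[ c ] Packed c G) → ∃ (IsPackedness G)
    packedness-exists (S₀ , ℓ₀ , clip₀) (c₀ , packed₀) =
      let s , upper , least = complete Ratio
            (ratio S₀ ℓ₀ , S₀ , ℓ₀ , clip₀ , ratio*r S₀ ℓ₀)
            (c₀ , λ x → ratio≤ packed₀)
      in s
       , (λ S ℓ clip → begin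
           sumOverEdges ℓ               ≈⟨ ratio*r S ℓ ⟨
           ratio S ℓ * Square.radius S  ≤⟨ *-monoˡ-≤ (proj₁ (Square.radius>0 S))
                                           (upper _ (S , ℓ , clip , ratio*r S ℓ)) ⟩
           s * Square.radius S          ∎)
       , λ c packed → least c λ x → ratio≤ packed
      where
      -- The packedness is the supremum of these ratios.
      Ratio : Carrier → Set
      Ratio x = ∃₂ λ S ℓ → IsClipping S ℓ × x * Square.radius S ≈ sumOverEdges ℓ

      r⁻¹ : ∀ S → ∃[ y ] Square.radius S * y ≈ 1#
      r⁻¹ S = inverse _ λ r≈0 → proj₂ (Square.radius>0 S) (R.sym r≈0)

      ratio : Square → (Edge → Carrier) → Carrier
      ratio S ℓ = sumOverEdges ℓ * proj₁ (r⁻¹ S)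

      ratio*r : ∀ S ℓ → ratio S ℓ * Square.radius S ≈ sumOverEdges ℓ
      ratio*r S ℓ = begin-equality
        sumOverEdges ℓ * proj₁ (r⁻¹ S) * Square.radius S    ≈⟨ R.*-assoc _ _ _ ⟩
        sumOverEdges ℓ * (proj₁ (r⁻¹ S) * Square.radius S)  ≈⟨ R.*-congˡ (R.*-comm _ _) ⟩
        sumOverEdges ℓ * (Square.radius S * proj₁ (r⁻¹ S))  ≈⟨ R.*-congˡ (proj₂ (r⁻¹ S)) ⟩
        sumOverEdges ℓ * 1#                                 ≈⟨ R.*-identityʳ _ ⟩
        sumOverEdges ℓ                                      ∎

      ratio≤ : ∀ {c x} → Packed c G → Ratio x → x ≤ c
      ratio≤ packed (S , ℓ , clip , eq) =
        *-cancelʳ-≤ (Square.radius>0 S) (≤-respˡ-≈ (R.sym eq) (packed S ℓ clip))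

-- The grid: constant density and linear packedness.

module GridGraph (ℝ : CompleteOrderedField) where

  open CompleteOrderedField ℝ
  open Geometry ℝ
  open OrderedFieldProperties ℝ
  open FiniteSums ℝ
  open PlaneGeometry ℝ
  open Packedness ℝ
  open ≤-Reasoning poset
  open GeometricGraph using (edges; Edge; IsEdge; isEdge?; sumOverEdges)

  isEdge : ∀ {n} (G : GeometricGraph n) {e} → e ∈ edges G → IsEdge G e
  isEdge {n} G e∈ = proj₂ (∈-filter⁻ (isEdge? G) {xs = cartesianProduct (allFin n) (allFin n)} e∈)

  ∈-edges : ∀ {n} (G : GeometricGraph n) {e} → IsEdge G e → e ∈ edges G
  ∈-edges G e-edge = ∈-filter⁺ (isEdge? G) (∈-cartesianProduct⁺ (∈-allFin _) (∈-allFin _)) e-edge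

  edges-unique : ∀ {n} (G : GeometricGraph n) → Unique (edges G)
  edges-unique {n} G = Unique.filter⁺ (isEdge? G)
    (Unique.cartesianProduct⁺ (Unique.allFin⁺ n) (Unique.allFin⁺ n))

  -- Low density

  unitBox : Point → Pred Point _
  unitBox (x , y) = Box (x - 1# , y - 1#) (x + 1# , y + 1#)

  -- Holds at both ends of a grid edge that meets `S`, because a unit edge stays within the unit box
  -- about either end.
  Near : Square → Point → Set
  Near S p = ∃[ z ] unitBox p z × Region S z

  -- Going from `p` to its witness, across the square and on to `q`, a coordinate changes by at most
  -- `1 + 2r + 1`, with `r ≤ 1`.
  near-≤ : ∀ {S p q} → Square.radius S ≤ 1# → Near S p → Near S q →
           proj₁ p ≤ proj₁ q + fromℕ 4 × proj₂ p ≤ proj₂ q + fromℕ 4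
  near-≤ {S} r≤1 (w , ((x₁ , _) , (y₁ , _)) , ((_ , x₂) , (_ , y₂)))
                 (z , ((_ , x₃) , (_ , y₃)) , ((x₄ , _) , (y₄ , _))) =
    coordinate x₁ x₂ x₃ x₄ , coordinate y₁ y₂ y₃ y₄
    where
    r = Square.radius S
    coordinate : ∀ {a x w y z} → x - 1# ≤ w → w ≤ a + r → z ≤ y + 1# → a - r ≤ z → x ≤ y + fromℕ 4
    coordinate {a} {x} {w} {y} {z} x-1≤w w≤a+r z≤y+1 a-r≤z = difference
      (+-nonNegative (+-nonNegative (x≤y⇒0≤y-x (≤.trans x-1≤w w≤a+r)) (x≤y⇒0≤y-x (≤.trans a-r≤z z≤y+1)))
        (+-nonNegative (x≤y⇒0≤y-x r≤1) (x≤y⇒0≤y-x r≤1)))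
      (solve 4 (λ a r x y →
          y :+ (con ℤ.1ℤ :+ (con ℤ.1ℤ :+ (con ℤ.1ℤ :+ (con ℤ.1ℤ :+ con ℤ.0ℤ)))) :- x
        := (a :+ r :- (x :- con ℤ.1ℤ)) :+ (y :+ con ℤ.1ℤ :- (a :- r))
           :+ ((con ℤ.1ℤ :- r) :+ (con ℤ.1ℤ :- r))) R.refl a r x y)

  unitBox-centre : ∀ p → unitBox p p
  unitBox-centre (x , y) = (below x , above x) , (below y , above y)
    where
    below : ∀ x → x - 1# ≤ x
    below x = difference 0≤1 (solve 1 (λ x → x :- (x :- con ℤ.1ℤ) := con ℤ.1ℤ) R.refl x)
    above : ∀ x → x ≤ x + 1#
    above x = difference 0≤1 (solve 1 (λ x → x :+ con ℤ.1ℤ :- x := con ℤ.1ℤ) R.refl x)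

  unitBox-neighbour : ∀ {p q} → IsDistance p q 1# → unitBox p q
  unitBox-neighbour {p} {q} d =
    (shift (distance-x {p} {q} d) , distance-x {q} {p} d′) ,
    (shift (distance-y {p} {q} d) , distance-y {q} {p} d′)
    where
    d′ = distance-sym {p} {q} d
    shift : ∀ {x y} → x ≤ y + 1# → x - 1# ≤ y
    shift {x} {y} x≤y+1 = difference (x≤y⇒0≤y-x x≤y+1)
      (solve 2 (λ x y → y :- (x :- con ℤ.1ℤ) := y :+ con ℤ.1ℤ :- x) R.refl x y)

  module _ (m : ℕ) where

    -- Indices that differ by at most 4 are separated by their residues modulo 5; two indices give
    -- `5 * 5` codes.
    vertexCode : Fin (m ℕ.* m) → Fin 25
    vertexCode v = combine (toℕ (Fin.quotient {m} m v) mod 5) (toℕ (Fin.remainder {m} m v) mod 5)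

    vertexCode-injective : ∀ {S u v} → Square.radius S ≤ 1# →
      Near S (gridPosition m u) → Near S (gridPosition m v) → vertexCode u ≡ vertexCode v → u ≡ v
    vertexCode-injective {S} {u} {v} r≤1 u-near v-near eq = quotient∧remainder-injective {m} m
      (coordinate (proj₁ u≤v) (proj₁ v≤u) (proj₁ codes))
      (coordinate (proj₂ u≤v) (proj₂ v≤u) (proj₂ codes))
      where
      codes = Fin.combine-injective
        (toℕ (Fin.quotient {m} m u) mod 5) (toℕ (Fin.remainder {m} m u) mod 5) _ _ eq
      u≤v = near-≤ {S} r≤1 u-near v-near
      v≤u = near-≤ {S} r≤1 v-near u-near
      bound : ∀ i j → fromℕ (suc i) ≤ fromℕ (suc j) + fromℕ 4 → i ℕ.≤ j ℕ.+ 4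
      bound i j le = ℕ.s≤s⁻¹ (fromℕ-cancel-≤ (suc i) (suc j ℕ.+ 4)
        (≤.≤-respʳ-≈ (R.sym (fromℕ-+ (suc j) 4)) le))
      coordinate : ∀ {i j : Fin m} →
        fromℕ (suc (toℕ i)) ≤ fromℕ (suc (toℕ j)) + fromℕ 4 →
        fromℕ (suc (toℕ j)) ≤ fromℕ (suc (toℕ i)) + fromℕ 4 →
        toℕ i mod 5 ≡ toℕ j mod 5 → i ≡ j
      coordinate {i} {j} i≤j+4 j≤i+4 codes =
        Fin.toℕ-injective (mod-injective-nearby 5 (ℕ.s≤s
          (∣m-n∣≤o (bound (toℕ i) (toℕ j) i≤j+4) (bound (toℕ j) (toℕ i) j≤i+4))) codes)

    -- An edge is coded by the codes of its two ends, whence `25 * 25` possibilities.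
    grid-lowDensity : LowDensity 625 (grid m)
    grid-lowDensity S es es! long = unique∧injective⇒length≤ edgeCode es! edgeCode-injective
      where
      open GeometricGraph (grid m) using (LongAndIntersecting; position)
      edgeCode : Edge (grid m) → Fin 625
      edgeCode (u , v) = combine (vertexCode u) (vertexCode v)

      ends : ∀ {u v} → IsEdge (grid m) (u , v) → LongAndIntersecting S (u , v) →
             Square.radius S ≤ 1# × Near S (position u) × Near S (position v)
      ends {u} {v} (_ , unit) ((d , dist , r<d) , z , z∈uv , z∈S) =
        -- Both `d` and `1#` are lengths of the edge, so the radius is at most 1. The single point
        -- `z` witnesses nearness of both ends.
        ≤.trans (proj₁ r<d) (distance-≤ {p} {q} dist unit) ,
        (z , segment⊆box {p} {q} (unitBox-centre p) (unitBox-neighbour {p} {q} unit) z∈uv , z∈S) ,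
        (z , segment⊆box {p} {q}
          (unitBox-neighbour {q} {p} (distance-sym {p} {q} unit)) (unitBox-centre q) z∈uv , z∈S)
        where
        p = position u
        q = position v

      ends′ : ∀ {u v} → (u , v) ∈ es → Square.radius S ≤ 1# × Near S (position u) × Near S (position v)
      ends′ e∈ = ends (isEdge (grid m) (proj₁ (All.lookup long e∈))) (proj₂ (All.lookup long e∈))

      edgeCode-injective : ∀ {e e′} → e ∈ es → e′ ∈ es → edgeCode e ≡ edgeCode e′ → e ≡ e′
      edgeCode-injective {u , v} {u′ , v′} e∈ e′∈ eq = ≡.cong₂ _,_
        (vertexCode-injective {S} (proj₁ near) (proj₁ (proj₂ near)) (proj₁ (proj₂ near′)) (proj₁ codes))
        (vertexCode-injective {S} (proj₁ near) (proj₂ (proj₂ near)) (proj₂ (proj₂ near′)) (proj₂ codes))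
        where
        near = ends′ e∈
        near′ = ends′ e′∈
        codes = Fin.combine-injective (vertexCode u) (vertexCode v) (vertexCode u′) (vertexCode v′) eq

  -- Packedness

  gridPosition-combine : ∀ {m} (i j : Fin m) →
    gridPosition m (combine i j) ≡ (fromℕ (suc (toℕ i)) , fromℕ (suc (toℕ j)))
  gridPosition-combine i j =
    ≡.cong (λ (a , b) → fromℕ (suc (toℕ a)) , fromℕ (suc (toℕ b))) (Fin.remQuot-combine i j)

  -- Coordinates start at one and indices at zero; the offset disappears because `∣_-_∣` of two
  -- successors reduces.
  sqDist-grid : ∀ {m} (i j i′ j′ : Fin m) →
    sqDist (gridPosition m (combine i j)) (gridPosition m (combine i′ j′)) ≈
    fromℕ (∣ toℕ i - toℕ i′ ∣ ℕ.* ∣ toℕ i - toℕ i′ ∣ ℕ.+ ∣ toℕ j - toℕ j′ ∣ ℕ.* ∣ toℕ j - toℕ j′ ∣)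
  sqDist-grid {m} i j i′ j′ = begin-equality
    sqDist (gridPosition m (combine i j)) (gridPosition m (combine i′ j′))
      ≡⟨ ≡.cong₂ sqDist (gridPosition-combine i j) (gridPosition-combine i′ j′) ⟩
    sqDist (fromℕ (suc (toℕ i)) , fromℕ (suc (toℕ j))) (fromℕ (suc (toℕ i′)) , fromℕ (suc (toℕ j′)))
      ≈⟨ R.+-cong (fromℕ-sqDiff (suc (toℕ i)) (suc (toℕ i′))) (fromℕ-sqDiff (suc (toℕ j)) (suc (toℕ j′))) ⟩
    fromℕ (∣ toℕ i - toℕ i′ ∣ ℕ.* ∣ toℕ i - toℕ i′ ∣) + fromℕ (∣ toℕ j - toℕ j′ ∣ ℕ.* ∣ toℕ j - toℕ j′ ∣)
      ≈⟨ fromℕ-+ (∣ toℕ i - toℕ i′ ∣ ℕ.* ∣ toℕ i - toℕ i′ ∣) _ ⟨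
    fromℕ (∣ toℕ i - toℕ i′ ∣ ℕ.* ∣ toℕ i - toℕ i′ ∣ ℕ.+ ∣ toℕ j - toℕ j′ ∣ ℕ.* ∣ toℕ j - toℕ j′ ∣) ∎

  1*1≈fromℕ1 : 1# * 1# ≈ fromℕ 1
  1*1≈fromℕ1 = R.trans (R.*-identityˡ 1#) (R.sym (R.+-identityʳ 1#))

  module _ (k : ℕ) where

    private
      m = suc k
      G = grid m

    -- Adjacency equates two natural numbers inside the field; `fromℕ-injective` returns the
    -- equation to `ℕ`, where only unit steps solve it.
    edges⊆rows++columns : ∀ {e} → e ∈ edges G → e ∈ rows k ++ columns k
    edges⊆rows++columns {u , v} e∈ =
      classify (Fin.combine-surjective {m} {m} u) (Fin.combine-surjective {m} {m} v) (isEdge G e∈)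
      where
      classify : ∀ {u v} → (∃₂ λ i j → combine {m} {m} i j ≡ u) → (∃₂ λ i j → combine {m} {m} i j ≡ v) →
                 IsEdge G (u , v) → (u , v) ∈ rows k ++ columns k
      classify (i , j , ≡.refl) (i′ , j′ , ≡.refl) (u<v , _ , 1*1≈) =
        unitStep∈lines k i j i′ j′ u<v (fromℕ-injective
          (R.trans (R.sym (sqDist-grid i j i′ j′)) (R.trans (R.sym 1*1≈) 1*1≈fromℕ1)))

    row-isEdge : ∀ i l → IsEdge G (step k combine i l)
    row-isEdge i l = combine-monoʳ-< i (ℕ.s≤s (ℕ.≤-reflexive (Fin.toℕ-inject₁ l))) , 0≤1 , (begin-equality
      1# * 1#   ≈⟨ 1*1≈fromℕ1 ⟩
      fromℕ 1   ≡⟨ ≡.cong₂ (λ x y → fromℕ (x ℕ.* x ℕ.+ y ℕ.* y)) (ℕ.∣n-n∣≡0 (toℕ i)) ∣l-1+l∣≡1 ⟨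
      fromℕ (∣ toℕ i - toℕ i ∣ ℕ.* ∣ toℕ i - toℕ i ∣
        ℕ.+ ∣ toℕ (inject₁ l) - suc (toℕ l) ∣ ℕ.* ∣ toℕ (inject₁ l) - suc (toℕ l) ∣)
                ≈⟨ sqDist-grid i (inject₁ l) i (suc l) ⟨
      sqDist (gridPosition m (combine i (inject₁ l))) (gridPosition m (combine i (suc l))) ∎)
      where
      ∣l-1+l∣≡1 : ∣ toℕ (inject₁ l) - suc (toℕ l) ∣ ≡ 1
      ∣l-1+l∣≡1 = ≡.trans (≡.cong ∣_- suc (toℕ l) ∣ (Fin.toℕ-inject₁ l))
        (∣n-1+n∣≡1 (toℕ l))

    rows⊆edges : ∀ {e} → e ∈ rows k → e ∈ edges G
    rows⊆edges e∈ with i , l , _ , _ , ≡.refl ← ∈-cartesianProductWith⁻ (step k combine) (allFin m) (allFin k) e∈ =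
      ∈-edges G (row-isEdge i l)

    rows-unique : Unique (rows k)
    rows-unique = Unique.cartesianProductWith⁺ (step k combine)
      -- The second end of a step already determines both its row and its place there.
      (λ {w} {x} {y} {z} eq →
        let w≡x , y≡z = Fin.combine-injective w (suc y) x (suc z) (≡.cong proj₂ eq)
        in w≡x , Fin.suc-injective y≡z)
      (Unique.allFin⁺ m) (Unique.allFin⁺ k)

    module _ (S : Square) where

      -- The signed difference is what telescopes; on the listed steps it is nonnegative and bounds
      -- the clipped length.
      weight : Edge G → Carrier
      weight (u , v) = potential S (gridPosition m v) - potential S (gridPosition m u)

      Ascending : Edge G → Set
      Ascending (u , v) = proj₁ (gridPosition m u) ≤ proj₁ (gridPosition m v)
                        × proj₂ (gridPosition m u) ≤ proj₂ (gridPosition m v)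

      combine-ascending : ∀ {i j i′ j′ : Fin m} → toℕ i ℕ.≤ toℕ i′ → toℕ j ℕ.≤ toℕ j′ →
                          Ascending (combine i j , combine i′ j′)
      combine-ascending {i} {j} {i′} {j′} i≤i′ j≤j′ =
        ≡.subst₂ (λ p q → proj₁ p ≤ proj₁ q × proj₂ p ≤ proj₂ q)
          (≡.sym (gridPosition-combine i j)) (≡.sym (gridPosition-combine i′ j′))
          (fromℕ-mono-≤ (ℕ.s≤s i≤i′) , fromℕ-mono-≤ (ℕ.s≤s j≤j′))

      inject₁≤suc : (l : Fin k) → toℕ (inject₁ l) ℕ.≤ suc (toℕ l)
      inject₁≤suc l = ℕ.m≤n⇒m≤1+n (ℕ.≤-reflexive (Fin.toℕ-inject₁ l))

      lines-ascending : (vertex : Fin m → Fin m → Fin (m ℕ.* m)) →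
        (∀ i l → Ascending (step k vertex i l)) → ∀ {e} → e ∈ lines k vertex → Ascending e
      lines-ascending vertex step-ascending e∈
        with i , l , _ , _ , ≡.refl ← ∈-cartesianProductWith⁻ (step k vertex) (allFin m) (allFin k) e∈ =
        step-ascending i l

      ascending : ∀ {e} → e ∈ rows k ++ columns k → Ascending e
      ascending e∈ =
        [ lines-ascending combine
            (λ i l → combine-ascending {i} {inject₁ l} {i} {suc l} ℕ.≤-refl (inject₁≤suc l))
        , lines-ascending (flip combine)
            (λ j l → combine-ascending {inject₁ l} {j} {suc l} {j} (inject₁≤suc l) ℕ.≤-refl)
        ]′ (∈-++⁻ (rows k) e∈)

      weight-nonNegative : ∀ {e} → e ∈ rows k ++ columns k → 0# ≤ weight e
      weight-nonNegative {u , v} e∈ = potential-mono S {gridPosition m u} {gridPosition m v}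
        (proj₁ (ascending e∈)) (proj₂ (ascending e∈))

      -- On each of the `m` lines the weights telescope to the difference between its extreme
      -- vertices, at most four radii however long the line is.
      lines-weight : (vertex : Fin m → Fin m → Fin (m ℕ.* m)) →
        sum weight (lines k vertex)
          ≤ fromℕ m * (fromℕ 4 * Square.radius S)
      lines-weight vertex = begin
        sum weight (lines k vertex)
          ≈⟨ sum-cartesianProductWith weight (step k vertex) (allFin m) (allFin k) ⟩
        sum (λ i → sum (λ l → Φ i (suc l) - Φ i (inject₁ l)) (allFin k)) (allFin m)
          ≤⟨ sum-mono-≤ (allFin m) (λ {i} _ → ≤-respˡ-≈ (R.sym (telescope k (Φ i)))
               (potential-spread S (gridPosition m (vertex i (Fin.fromℕ k))) (gridPosition m (vertex i zero)))) ⟩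
        sum (λ _ → fromℕ 4 * Square.radius S) (allFin m)
          ≈⟨ sum-const (fromℕ 4 * Square.radius S) (allFin m) ⟩
        fromℕ (length (allFin m)) * (fromℕ 4 * Square.radius S)
          ≡⟨ ≡.cong (λ n → fromℕ n * (fromℕ 4 * Square.radius S)) (List.length-tabulate {n = m} (λ i → i)) ⟩
        fromℕ m * (fromℕ 4 * Square.radius S) ∎
        where
        Φ : Fin m → Fin m → Carrier
        Φ i l = potential S (gridPosition m (vertex i l))

      -- Weights replace clipped lengths edge by edge, and the lists of lines then replace `edges`.
      -- Rows and columns contribute four radii per line, on `m` lines each.
      clippedLength-grid : ∀ {ℓ} → IsClipping G S ℓ → sumOverEdges G ℓ ≤ fromℕ 8 * fromℕ m * Square.radius S
      clippedLength-grid {ℓ} clip = begin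
        sum ℓ (edges G)
          ≤⟨ sum-mono-≤ (edges G) (λ {(u , v)} e∈ →
               let x≤ , y≤ = ascending (edges⊆rows++columns e∈)
               in clippedLength-≤ S {gridPosition m u} {gridPosition m v} x≤ y≤ (clip _ e∈)) ⟩
        sum weight (edges G)
          ≤⟨ sum-⊆ (edges-unique G) edges⊆rows++columns weight-nonNegative ⟩
        sum weight (rows k ++ columns k)
          ≈⟨ sum-++ weight (rows k) (columns k) ⟩
        sum weight (rows k) + sum weight (columns k)
          ≤⟨ +-mono-≤ (lines-weight combine) (lines-weight (flip combine)) ⟩
        fromℕ m * (fromℕ 4 * r) + fromℕ m * (fromℕ 4 * r)
          ≈⟨ solve 3 (λ m f r → m :* (f :* r) :+ m :* (f :* r) := (f :+ f) :* m :* r)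
               R.refl (fromℕ m) (fromℕ 4) r ⟩
        (fromℕ 4 + fromℕ 4) * fromℕ m * r
          ≈⟨ R.*-congʳ (R.*-congʳ (fromℕ-+ 4 4)) ⟨
        fromℕ 8 * fromℕ m * r ∎
        where r = Square.radius S

  grid-packed : ∀ m → Packed (fromℕ 8 * fromℕ m) (grid m)
  -- The empty grid has sum zero, so the bound only has to be nonnegative.
  grid-packed zero    S ℓ _    = *-nonNegative (*-nonNegative (0≤fromℕ 8) ≤.refl) (proj₁ (Square.radius>0 S))
  grid-packed (suc k) S ℓ clip = clippedLength-grid k S clip

  -- The index is one less than the radius, which keeps the radius positive.
  squareAtOrigin : ℕ → Square
  squareAtOrigin k = record { centre = 0# , 0# ; radius = fromℕ (suc k) ; radius>0 = 0<fromℕ-suc k }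

  gridPosition∈square : ∀ m k → m ℕ.≤ suc k → ∀ v → Region (squareAtOrigin k) (gridPosition m v)
  gridPosition∈square m k m≤1+k v =
    coordinate (Fin.quotient {m} m v) , coordinate (Fin.remainder {m} m v)
    where
    r = fromℕ (suc k)
    coordinate : (i : Fin m) → 0# - r ≤ fromℕ (suc (toℕ i)) × fromℕ (suc (toℕ i)) ≤ 0# + r
    coordinate i =
      difference (+-nonNegative (0≤fromℕ (suc (toℕ i))) (0≤fromℕ (suc k)))
        (solve 2 (λ x r → x :- (con ℤ.0ℤ :- r) := x :+ r) R.refl (fromℕ (suc (toℕ i))) r) ,
      ≤.≤-respʳ-≈ (R.sym (R.+-identityˡ r)) (fromℕ-mono-≤ (ℕ.≤-trans (Fin.toℕ<n i) m≤1+k))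

  -- By convexity each edge lies wholly in the square, so its clipped part is the edge itself.
  unclipped : ∀ m k → m ℕ.≤ suc k → IsClipping (grid m) (squareAtOrigin k) (λ _ → 1#)
  unclipped m k m≤1+k (u , v) e∈ = inj₂ (p , q , (proj₁ , (λ z∈pq → z∈pq ,
    segment⊆box {p} {q} (gridPosition∈square m k m≤1+k u) (gridPosition∈square m k m≤1+k v) z∈pq)) ,
    proj₂ (isEdge (grid m) e∈))
    where
    p = gridPosition m u
    q = gridPosition m v

  packedness : ∀ m → ∃ (IsPackedness (grid m))
  packedness m = packedness-exists (grid m)
    -- Radius `m + 1` rather than `m`, to include the empty grid.
    (squareAtOrigin m , _ , unclipped m m (ℕ.n≤1+n m)) (_ , grid-packed m)

  -- The rows hold `m * k` unit edges inside a square of radius `m`, and `m` cancels.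
  packed⇒k≤c : ∀ {k c} → Packed c (grid (suc k)) → fromℕ k ≤ c
  packed⇒k≤c {k} {c} packed = *-cancelʳ-≤ (0<fromℕ-suc k) (begin
    fromℕ k * fromℕ m                              ≈⟨ R.*-comm _ _ ⟩
    fromℕ m * fromℕ k                              ≡⟨ ≡.cong₂ (λ a b → fromℕ a * fromℕ b)
      (List.length-tabulate {n = m} (λ i → i)) (List.length-tabulate {n = k} (λ i → i)) ⟨
    fromℕ (length (allFin m)) * fromℕ (length (allFin k))
      ≈⟨ R.*-congˡ (R.trans (sum-const 1# (allFin k)) (R.*-identityʳ _)) ⟨
    fromℕ (length (allFin m)) * sum (λ _ → 1#) (allFin k)
      ≈⟨ sum-const (sum (λ _ → 1#) (allFin k)) (allFin m) ⟨
    sum (λ _ → sum (λ _ → 1#) (allFin k)) (allFin m)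
      ≈⟨ sum-cartesianProductWith (λ _ → 1#) (step k combine) (allFin m) (allFin k) ⟨
    sum (λ _ → 1#) (rows k)
      -- Leaving out the columns halves the count, which a bound up to constants absorbs.
      ≤⟨ sum-⊆ (rows-unique k) (rows⊆edges k) (λ _ → 0≤1) ⟩
    sum (λ _ → 1#) (edges (grid m))
      ≤⟨ packed (squareAtOrigin k) (λ _ → 1#) (unclipped m k ℕ.≤-refl) ⟩
    c * fromℕ m ∎)
    where m = suc k

  half : ∃[ h ] h * fromℕ 2 ≈ 1#
  half = let h , eq = inverse (fromℕ 2) (λ 2≈0 → proj₂ (0<fromℕ-suc 1) (R.sym 2≈0))
         in h , R.trans (R.*-comm _ _) eq

  0<half : 0# < proj₁ half
  0<half = ≰⇒> λ h≤0 → <⇒≱ 0<1 (begin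
    1#                    ≈⟨ proj₂ half ⟨
    proj₁ half * fromℕ 2  ≤⟨ *-monoˡ-≤ (0≤fromℕ 2) h≤0 ⟩
    0# * fromℕ 2          ≈⟨ R.zeroˡ _ ⟩
    0#                    ∎)

  -- `m - 1` is at least `m / 2` once `m` is at least 2, whence the lower constant and the
  -- threshold; the upper constant comes from `grid-packed`.
  packedness-Θ : (λ m → proj₁ (packedness m)) ∈Θ fromℕ
  packedness-Θ = h , fromℕ 8 , 0<half , 0<fromℕ-suc 7 , 2 , bounds
    where
    h = proj₁ half
    bounds : ∀ m → 2 ℕ.≤ m → 0# ≤ h * fromℕ m × h * fromℕ m ≤ proj₁ (packedness m)
                             × proj₁ (packedness m) ≤ fromℕ 8 * fromℕ m
    bounds (suc zero) (ℕ.s≤s ())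
    bounds m@(suc k@(suc j)) _ =
      *-nonNegative (proj₁ 0<half) (0≤fromℕ m) ,
      (begin
        -- With `m = j + 2` and `k = j + 1`, the gap `2hk - hm` equals `hj`.
        h * fromℕ m            ≤⟨ difference (*-nonNegative (proj₁ 0<half) (0≤fromℕ j))
          (solve 2 (λ h n → h :* (con ℤ.1ℤ :+ (con ℤ.1ℤ :+ con ℤ.0ℤ)) :* (con ℤ.1ℤ :+ n)
                            :- h :* (con ℤ.1ℤ :+ (con ℤ.1ℤ :+ n)) := h :* n) R.refl h (fromℕ j)) ⟩
        h * fromℕ 2 * fromℕ k  ≈⟨ R.*-congʳ (proj₂ half) ⟩
        1# * fromℕ k           ≈⟨ R.*-identityˡ _ ⟩
        fromℕ k                ≤⟨ packed⇒k≤c (proj₁ (proj₂ (packedness m))) ⟩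
        proj₁ (packedness m)   ∎) ,
      proj₂ (proj₂ (packedness m)) _ (grid-packed m)

mainTheorem2 :
    (ℝ : CompleteOrderedField) →
    let open CompleteOrderedField ℝ
        open Geometry ℝ
    in (∃[ λ₀ ] ∀ (m : ℕ) → LowDensity λ₀ (grid m))
       × (∃[ c ] (∀ (m : ℕ) → IsPackedness (grid m) (c m)) × c ∈Θ fromℕ)
mainTheorem2 ℝ =
  (625 , grid-lowDensity) ,
  ((λ m → proj₁ (packedness m)) , (λ m → proj₂ (packedness m)) , packedness-Θ)
  where open GridGraph ℝ
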